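{- For every integer $r\ge 1$, setting $m=2r$, there exists a connected graph $G_m$ such that $$\gamma_g(T)-\gamma_g(G_m)\ge r-1$$ holds for every spanning tree $T$ of $G_m$.
   Context: Graphs are finite, simple and nonempty. A spanning tree of $G$ is a subgraph of $G$ that is a tree and has the same vertex set as $G$. For a vertex $v$, $N[v]$ is its closed neighborhood; a chosen vertex $v$ dominates all vertices of $N[v]$. The domination game on a graph $G$ is played by two players, Dominator and Staller, who alternately choose vertices of $G$; each chosen vertex must dominate at least one vertex that was not dominated by the previously chosen vertices. The game ends when all vertices of $G$ are dominated. Dominator wants the total number of chosen vertices to be as small as possible, Staller wants it to be as large as possible. The game domination number $\gamma_g(G)$ is the total number of vertices chosen (by both players) when Dominator makes the first move and both players play optimally. -}

module Defs where

open import Data.Fin.Base using (Fin; zero; suc; inject₁; fromℕ)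
open import Data.Fin.Properties using (_≟_; any?)
open import Data.Fin.Subset using (Subset; _∈_; _∉_; _⊃_; _∪_; ⊥)
open import Data.Fin.Subset.Induction using (⊃-wellFounded)
open import Data.Fin.Subset.Properties using (_∈?_; p⊆p∪q; q⊆p∪q)
open import Data.List.Base using (List; []; _∷_; map; mapMaybe; allFin)
open import Data.List.Extrema.Nat using (min; max)
import Data.Maybe.Base as Maybe
open import Data.Nat.Base using (ℕ; suc; _+_; NonZero)
open import Data.Product.Base using (Σ; ∃; _×_; _,_)
open import Data.Vec.Base using (tabulate)
open import Function.Definitions using (Injective)
open import Induction.WellFounded using (Acc; acc)
open import Level using (0ℓ)
open import Relation.Binary.Core using (Rel)
open import Relation.Binary.Construct.Closure.ReflexiveTransitive using (Star)
open import Relation.Binary.Definitions using (Symmetric; Irreflexive; Decidable)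
open import Relation.Binary.PropositionalEquality.Core using (_≡_)
open import Relation.Nullary using (Dec; does; ¬_; ¬?; _×-dec_; _⊎-dec_)
open import Relation.Nullary.Decidable using (dec⇒maybe)

-- Finite, simple, nonempty graphs with vertex set Fin n.
record Graph (n : ℕ) : Set₁ where
  field
    nonempty : NonZero n
    Adj      : Rel (Fin n) 0ℓ
    adj?     : Decidable Adj
    symAdj   : Symmetric Adj
    irrefl   : Irreflexive _≡_ Adj

open Graph public

module _ {n : ℕ} where

  Connected : Graph n → Set
  Connected G = ∀ u v → Star (Adj G) u v

  -- A cycle visits 3 + k distinct vertices c 0, …, c (2 + k); the last field
  -- is the closing edge.
  record Cycle (G : Graph n) : Set where
    field
      k        : ℕ
      c        : Fin (3 + k) → Fin n
      distinct : Injective _≡_ _≡_ c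
      step     : ∀ (i : Fin (2 + k)) → Adj G (c (inject₁ i)) (c (suc i))
      close    : Adj G (c (fromℕ (2 + k))) (c zero)

  IsTree : Graph n → Set
  IsTree G = Connected G × ¬ Cycle G

  -- T and G share the vertex set Fin n, so only edges need to be compared.
  IsSpanningTree : (T G : Graph n) → Set
  IsSpanningTree T G = (∀ {u v} → Adj T u v → Adj G u v) × IsTree T

data Player : Set where
  Dominator Staller : Player

opponent : Player → Player
opponent Dominator = Staller
opponent Staller   = Dominator

best : Player → ℕ → List ℕ → ℕ
best Dominator = min
best Staller   = max

-- Number of moves still to be played by optimal players, p moving next, given
-- the list of the numbers of moves that would follow each legal move of p.
score : Player → List ℕ → ℕ
score p []       = 0
score p (k ∷ ks) = suc (best p k ks)

module DominationGame {n : ℕ} (G : Graph n) where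

  N[_] : Fin n → Subset n
  N[ v ] = tabulate λ u → does ((u ≟ v) ⊎-dec adj? G v u)

  -- A position is the set D of vertices dominated by the moves made so far.
  Legal : Subset n → Fin n → Set
  Legal D v = ∃ λ u → u ∈ N[ v ] × u ∉ D

  legal? : ∀ D v → Dec (Legal D v)
  legal? D v = any? λ u → (u ∈? N[ v ]) ×-dec ¬? (u ∈? D)

  legal⇒⊃ : ∀ {D v} → Legal D v → (D ∪ N[ v ]) ⊃ D
  legal⇒⊃ {D} {v} (u , u∈N , u∉D) = p⊆p∪q N[ v ] , u , q⊆p∪q D N[ v ] u∈N , u∉D

  legalMoves : ∀ D → List (Σ (Fin n) (Legal D))
  legalMoves D = mapMaybe (λ v → Maybe.map (v ,_) (dec⇒maybe (legal? D v))) (allFin n)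

  -- An undominated vertex is itself a legal move, so there is no legal move
  -- exactly when all vertices are dominated, i.e. when the game ends.
  movesLeft : Player → ∀ D → Acc _⊃_ D → ℕ
  movesLeft p D (acc rs) =
    score p (map (λ (v , l) → movesLeft (opponent p) (D ∪ N[ v ]) (rs (legal⇒⊃ l)))
                 (legalMoves D))

  gameDominationNumber : ℕ
  gameDominationNumber = movesLeft Dominator ⊥ (⊃-wellFounded ⊥)

γg : ∀ {n} → Graph n → ℕ
γg = DominationGame.gameDominationNumber

{-# OPTIONS --safe #-}

-- Let Gₘ consist of M = m + 1 disjoint copies of K₄, with one vertex of each
-- copy chosen and the chosen vertices joined pairwise. The M copies and the
-- clique of chosen vertices cover all edges, and every move completes the
-- domination of at least one of these M + 1 cliques, so γg(Gₘ) ≤ M + 1 however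
-- the game is played.
--
-- In a spanning tree T, the three unchosen vertices of a copy have all their
-- neighbours in that copy and do not form a triangle, so as long as none of them
-- is dominated, Staller can play one of them and leave another undominated. Give
-- such a triple weight 3 while it is untouched, 2 while it is partly dominated
-- and 0 once it is dominated. Dominator lowers the total weight by at most 3 per
-- move, and Staller can lower it by only 1 while there are untouched triples;
-- afterwards every move lowers it by at most 2. So 3M ≤ 1 + 2 γg(T).

module Submission where

open import Defs
open import Algebra.Properties.CommutativeSemigroup using (x∙yz≈y∙xz)
open import Algebra.Properties.Monoid.Sum using () renaming (sum to monoidSum)
open import Data.Bool.Base using (if_then_else_)
open import Data.Fin.Base using (Fin; zero; suc; combine; quotient; remainder)
open import Data.Fin.Patterns using (0F; 1F; 2F)
open import Data.Fin.Properties
  using (_≟_; all?; combine-injectiveʳ; remQuot-combine; suc-injective; ¬∀⟶∃¬)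
open import Data.Fin.Subset using (Subset; _∈_; _∉_; _⊆_; _⊃_; _∪_; _∩_; ⊥; Nonempty)
open import Data.Fin.Subset.Induction using (⊃-wellFounded)
open import Data.Fin.Subset.Properties
  using (_∈?_; _⊆?_; nonempty?; ∉⊥; p⊆p∪q; q⊆p∪q; x∈p∩q⁺; x∈p∩q⁻; x∈p∪q⁻)
open import Data.Integer.Base using (+_; _-_; _≥_; 1ℤ; _⊖_) renaming (_≤_ to _≤ᶻ_)
import Data.Integer.Properties as ℤ
open import Data.List.Base using (List; []; _∷_; map; allFin)
open import Data.List.Extrema.Nat using (argmin-sel; argmax-sel; ⊥≤max; xs≤max)
import Data.List.Membership.Propositional as List
open import Data.List.Membership.Propositional.Properties using (∈-allFin; ∈-map⁺; ∈-map⁻)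
open import Data.List.Relation.Unary.All using (lookup)
import Data.List.Relation.Unary.Any as Any
import Data.List.Relation.Unary.Any.Properties as Any
import Data.Maybe.Base as Maybe
import Data.Maybe.Relation.Unary.Any as MaybeAny
open import Data.Nat.Base as ℕ using (ℕ; zero; suc; _+_; _*_; _≤_; z≤n; s≤s)
open import Data.Nat.Properties
  using (+-0-monoid; +-commutativeSemigroup; +-assoc; +-mono-≤; +-monoʳ-≤; +-monoˡ-≤; +-comm;
         *-cancelˡ-≤; *-monoʳ-≤; *-identityʳ; *-zeroʳ; *-distribˡ-+;
         m≤m+n; ≤-refl; ≤-reflexive; ≤-trans; module ≤-Reasoning)
open import Data.Nat.Tactic.RingSolver using (solve-∀)
open import Data.Product.Base
  using (Σ; Σ-syntax; ∃; ∃₂; ∃-syntax; _×_; _,_; proj₁; proj₂)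
open import Data.Sum.Base using (_⊎_; inj₁; inj₂)
open import Data.Vec.Base using (tabulate)
open import Data.Vec.Properties using (lookup∘tabulate; []=⇒lookup; lookup⇒[]=)
open import Function.Base using (_∘_; id)
open import Induction.WellFounded using (Acc; acc)
open import Level using (0ℓ)
open import Relation.Binary.Construct.Closure.ReflexiveTransitive using (Star; ε; _◅_; _◅◅_)
open import Relation.Binary.PropositionalEquality
  using (_≡_; _≢_; refl; sym; trans; cong; cong₂; subst)
open import Relation.Nullary
  using (Dec; yes; no; does; ¬_; ¬?; _×-dec_; _⊎-dec_; contradiction)
open import Relation.Nullary.Decidable using (dec⇒maybe; dec-true; decidable-stable)
import Relation.Unary as Unary

-- Finite sums of natural numbers.

sum : ∀ {n} → (Fin n → ℕ) → ℕ
sum = monoidSum +-0-monoid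

sum-mono : ∀ {n} {f g : Fin n → ℕ} → (∀ i → f i ≤ g i) → sum f ≤ sum g
sum-mono {zero}  f≤g = z≤n
sum-mono {suc n} f≤g = +-mono-≤ (f≤g zero) (sum-mono (f≤g ∘ suc))

sum-const : ∀ n c → sum {n} (λ _ → c) ≡ n * c
sum-const zero    c = refl
sum-const (suc n) c = cong (_+_ c) (sum-const n c)

-- Serves for potentials of which a move is charged at a single index: that index absorbs both
-- offsets, the others are compared termwise.
sum-mono-except : ∀ {n} {f g : Fin n → ℕ} {a b} i → a + f i ≤ b + g i →
  (∀ j → j ≢ i → f j ≤ g j) → a + sum f ≤ b + sum g
sum-mono-except {suc n} {f} {g} {a} {b} zero fi≤gi f≤g = begin
  a + (f zero + sum (f ∘ suc)) ≡⟨ +-assoc a (f zero) _ ⟨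
  a + f zero + sum (f ∘ suc)   ≤⟨ +-mono-≤ fi≤gi (sum-mono λ j → f≤g (suc j) λ ()) ⟩
  b + g zero + sum (g ∘ suc)   ≡⟨ +-assoc b (g zero) _ ⟩
  b + (g zero + sum (g ∘ suc)) ∎
  where open ≤-Reasoning
sum-mono-except {suc n} {f} {g} {a} {b} (suc i) fi≤gi f≤g = begin
  a + (f zero + sum (f ∘ suc)) ≡⟨ x∙yz≈y∙xz +-commutativeSemigroup a (f zero) _ ⟩
  f zero + (a + sum (f ∘ suc)) ≤⟨ +-mono-≤ (f≤g zero λ ())
                                    (sum-mono-except i fi≤gi λ j j≢i → f≤g (suc j) (j≢i ∘ suc-injective)) ⟩
  g zero + (b + sum (g ∘ suc)) ≡⟨ x∙yz≈y∙xz +-commutativeSemigroup (g zero) b _ ⟩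
  b + (g zero + sum (g ∘ suc)) ∎
  where open ≤-Reasoning

-- Subsets cut out by decidable predicates.

module _ {n} {P : Unary.Pred (Fin n) 0ℓ} where

  ⟦_⟧ : Unary.Decidable P → Subset n
  ⟦ P? ⟧ = tabulate (does ∘ P?)

  ∈⟦⟧⁺ : (P? : Unary.Decidable P) → ∀ {x} → P x → x ∈ ⟦ P? ⟧
  ∈⟦⟧⁺ P? {x} px = lookup⇒[]= x _ (trans (lookup∘tabulate (does ∘ P?) x) (dec-true (P? x) px))

  ∈⟦⟧⁻ : (P? : Unary.Decidable P) → ∀ {x} → x ∈ ⟦ P? ⟧ → P x
  ∈⟦⟧⁻ P? {x} x∈P with P? x | trans (sym (lookup∘tabulate (does ∘ P?) x)) ([]=⇒lookup x∈P)
  ... | yes px | _ = px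

-- Optimal play.

best-sel : ∀ p k ks → best p k ks ≡ k ⊎ best p k ks List.∈ ks
best-sel Dominator = argmin-sel id
best-sel Staller   = argmax-sel id

module _ {A : Set} (f : A → ℕ) where

  -- Both `min` and `max` are attained, so an optimal score comes from an actual move; a bound valid
  -- for all moves of a player then bounds the score.
  score-sel : ∀ p xs →
    (score p (map f xs) ≡ 0 × ∀ x → ¬ x List.∈ xs) ⊎ ∃ λ x → score p (map f xs) ≡ suc (f x)
  score-sel p []       = inj₁ (refl , λ _ ())
  score-sel p (x ∷ xs) with best-sel p (f x) (map f xs)
  ... | inj₁ ≡fx = inj₂ (x , cong suc ≡fx)
  ... | inj₂ ∈fxs with y , _ , ≡fy ← ∈-map⁻ f ∈fxs = inj₂ (y , cong suc ≡fy)

  -- Staller maximizes, so exhibiting one good move suffices for a lower bound.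
  ∈⇒<score-Staller : ∀ {x xs} → x List.∈ xs → suc (f x) ≤ score Staller (map f xs)
  ∈⇒<score-Staller {xs = y ∷ ys} (Any.here refl)  = s≤s (⊥≤max (f y) (map f ys))
  ∈⇒<score-Staller {xs = y ∷ ys} (Any.there x∈ys) = s≤s (lookup (xs≤max (f y) (map f ys)) (∈-map⁺ f x∈ys))

Any-just : ∀ {A : Set} {B : A → Set} {x} → B x → (b? : Dec (B x)) →
  MaybeAny.Any (λ m → proj₁ m ≡ x) (Maybe.map {B = Σ A B} (x ,_) (dec⇒maybe b?))
Any-just b (yes _) = MaybeAny.just refl
Any-just b (no ¬b) = contradiction b ¬b

module Game {n} (G : Graph n) where

  open DominationGame G public

  inN? : ∀ v u → Dec (u ≡ v ⊎ Adj G v u)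
  inN? v u = (u ≟ v) ⊎-dec adj? G v u

  -- The list stores the proof found by `legal?`, whose newly dominated vertex may differ from the
  -- given one; hence the existential over `l`.
  legal⇒∈legalMoves : ∀ {D v} → Legal D v → ∃ λ l → (v , l) List.∈ legalMoves D
  legal⇒∈legalMoves {D} {v} l
    with (_ , l′) , ∈moves , refl ← List.find {P = λ m → proj₁ m ≡ v}
           (Any.mapMaybe⁺ _ (allFin n) (Any.map⁺
             (List.lose (∈-allFin v) (Any-just {B = Legal D} l (legal? D v)))))
    = l′ , ∈moves

  module _ {D : Subset n} (rs : ∀ {D′} → D′ ⊃ D → Acc _⊃_ D′) where

    movesLeft-sel : ∀ p →
      (movesLeft p D (acc rs) ≡ 0 × ∀ v → ¬ Legal D v) ⊎
      ∃₂ λ v (l : Legal D v) →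
        movesLeft p D (acc rs) ≡ suc (movesLeft (opponent p) (D ∪ N[ v ]) (rs (legal⇒⊃ l)))
    movesLeft-sel p with score-sel _ p (legalMoves D)
    ... | inj₁ (≡0 , empty)  = inj₁ (≡0 , λ v l → empty _ (proj₂ (legal⇒∈legalMoves l)))
    ... | inj₂ ((v , l) , e) = inj₂ (v , l , e)

    legal⇒<movesLeft-Staller : ∀ {v} → Legal D v → ∃ λ l →
      suc (movesLeft Dominator (D ∪ N[ v ]) (rs (legal⇒⊃ l))) ≤ movesLeft Staller D (acc rs)
    legal⇒<movesLeft-Staller l with l′ , ∈moves ← legal⇒∈legalMoves l = l′ , ∈⇒<score-Staller _ ∈moves

-- Upper bound on the game from an edge clique cover.

module EdgeCliqueCover {n k} (G : Graph n) (K : Fin k → Subset n)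
  (clique : ∀ c {u v} → u ∈ K c → v ∈ K c → u ∈ Game.N[_] G v)
  (cover  : ∀ {u v} → u ∈ Game.N[_] G v → ∃ λ c → u ∈ K c × v ∈ K c) where

  open Game G

  undominated : Subset n → Fin k → ℕ
  undominated D c = if does (K c ⊆? D) then 0 else 1

  undominated≤1 : ∀ D c → undominated D c ≤ 1
  undominated≤1 D c with K c ⊆? D
  ... | yes _ = z≤n
  ... | no  _ = ≤-refl

  undominated-antitone : ∀ {D D′} → D ⊆ D′ → ∀ c → undominated D′ c ≤ undominated D c
  undominated-antitone {D} {D′} D⊆D′ c with K c ⊆? D′ | K c ⊆? D
  ... | yes _    | _       = z≤n
  ... | no _     | no _    = ≤-refl
  ... | no K⊈D′  | yes K⊆D = contradiction (λ {x} x∈K → D⊆D′ (K⊆D x∈K)) K⊈D′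

  -- A newly dominated `u` shares a clique with `v`. That clique was incomplete because of `u`, and
  -- now lies inside `N[ v ]`.
  move-undominated : ∀ {D v} → Legal D v →
    suc (sum (undominated (D ∪ N[ v ]))) ≤ sum (undominated D)
  move-undominated {D} {v} (u , u∈N , u∉D) with c , u∈K , v∈K ← cover u∈N =
    sum-mono-except c drop λ j _ → undominated-antitone (p⊆p∪q N[ v ]) j
    where
    drop : suc (undominated (D ∪ N[ v ]) c) ≤ undominated D c
    drop with K c ⊆? (D ∪ N[ v ]) | K c ⊆? D
    ... | yes _  | no _    = ≤-refl
    ... | _      | yes K⊆D = contradiction (K⊆D u∈K) u∉D
    ... | no K⊈  | no _    = contradiction (λ {x} x∈K → q⊆p∪q D N[ v ] (clique c x∈K v∈K)) K⊈

  -- The number of incomplete cliques is a potential that every move, by either player, lowers by at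
  -- least one.
  movesLeft≤ : ∀ p D a → movesLeft p D a ≤ sum (undominated D)
  movesLeft≤ p D (acc rs) with movesLeft-sel rs p
  ... | inj₁ (≡0 , _)   = ≤-trans (≤-reflexive ≡0) z≤n
  ... | inj₂ (v , l , e) = ≤-trans (≤-reflexive e)
    (≤-trans (s≤s (movesLeft≤ (opponent p) _ (rs (legal⇒⊃ l)))) (move-undominated l))

  γg≤k : γg G ≤ k
  γg≤k = begin
    γg G                ≤⟨ movesLeft≤ Dominator ⊥ (⊃-wellFounded ⊥) ⟩
    sum (undominated ⊥) ≤⟨ sum-mono {k} (undominated≤1 ⊥) ⟩
    sum {k} (λ _ → 1)   ≡⟨ sum-const k 1 ⟩
    k * 1               ≡⟨ *-identityʳ k ⟩
    k                   ∎
    where open ≤-Reasoning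

-- Lower bound on the game from sets with private neighborhoods.

module PrivateSets {n k} (T : Graph n) (S : Fin k → Subset n) (home : Fin n → Fin k)
  (private-nbhd : ∀ {i u v} → u ∈ S i → u ∈ Game.N[_] T v → i ≡ home v)
  (non-nbr : ∀ i → ∃₂ λ v u → v ∈ S i × u ∈ S i × u ∉ Game.N[_] T v) where

  open Game T

  v∈N[v] : ∀ v → v ∈ N[ v ]
  v∈N[v] v = ∈⟦⟧⁺ (inN? v) (inj₁ refl)

  weight : Subset n → Fin k → ℕ
  weight D i = if does (S i ⊆? D) then 0 else if does (nonempty? (S i ∩ D)) then 2 else 3

  weight≤3 : ∀ D i → weight D i ≤ 3
  weight≤3 D i with S i ⊆? D | nonempty? (S i ∩ D)
  ... | yes _ | _     = z≤n
  ... | no _  | yes _ = s≤s (s≤s z≤n)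
  ... | no _  | no _  = ≤-refl

  touched⇒weight≤2 : ∀ {D i} → Nonempty (S i ∩ D) → weight D i ≤ 2
  touched⇒weight≤2 {D} {i} touched with S i ⊆? D | nonempty? (S i ∩ D)
  ... | yes _ | _      = z≤n
  ... | no _  | yes _  = ≤-refl
  ... | no _  | no ¬t  = contradiction touched ¬t

  incomplete⇒2≤weight : ∀ {D i x} → x ∈ S i → x ∉ D → 2 ≤ weight D i
  incomplete⇒2≤weight {D} {i} x∈S x∉D with S i ⊆? D | nonempty? (S i ∩ D)
  ... | yes S⊆D | _     = contradiction (S⊆D x∈S) x∉D
  ... | no _    | yes _ = ≤-refl
  ... | no _    | no _  = s≤s (s≤s z≤n)

  complete⇒weight≤0 : ∀ {D i} → S i ⊆ D → weight D i ≤ 0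
  complete⇒weight≤0 {D} {i} S⊆D with S i ⊆? D
  ... | yes _ = z≤n
  ... | no S⊈ = contradiction (λ {x} → S⊆D {x}) S⊈

  weight⊥ : ∀ i → 3 ≤ weight ⊥ i
  weight⊥ i with S i ⊆? ⊥ | nonempty? (S i ∩ ⊥)
  -- The witnesses of `non-nbr` show that `S i` is nonempty, so it is not complete at the start.
  ... | yes S⊆⊥ | _           = contradiction (S⊆⊥ (proj₁ (proj₂ (proj₂ (non-nbr i))))) ∉⊥
  ... | no _    | yes (x , t) = contradiction (proj₂ (x∈p∩q⁻ (S i) ⊥ t)) ∉⊥
  ... | no _    | no _        = ≤-refl

  -- By `private-nbhd`, `N[ v ]` misses `S j`, so the move changes nothing there.
  weight-away : ∀ D v j → j ≢ home v → weight D j ≤ weight (D ∪ N[ v ]) j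
  weight-away D v j j≢ with S j ⊆? (D ∪ N[ v ]) | nonempty? (S j ∩ (D ∪ N[ v ]))
  -- The weight after the move is already the maximal value 3.
  ... | no _      | no _  = weight≤3 D j
  ... | yes S⊆D∪N | _     = complete⇒weight≤0 λ x∈S → old x∈S (S⊆D∪N x∈S)
    where
    old : ∀ {x} → x ∈ S j → x ∈ D ∪ N[ v ] → x ∈ D
    old x∈S x∈D∪N with x∈p∪q⁻ D N[ v ] x∈D∪N
    ... | inj₁ x∈D = x∈D
    ... | inj₂ x∈N = contradiction (private-nbhd x∈S x∈N) j≢
  ... | no _ | yes (x , t) with x∈S , x∈D∪N ← x∈p∩q⁻ (S j) _ t with x∈p∪q⁻ D N[ v ] x∈D∪N
  ...   | inj₁ x∈D = touched⇒weight≤2 (x , x∈p∩q⁺ (x∈S , x∈D))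
  ...   | inj₂ x∈N = contradiction (private-nbhd x∈S x∈N) j≢

  total : Subset n → ℕ
  total D = sum (weight D)

  move-total : ∀ D v b → weight D (home v) ≤ b + weight (D ∪ N[ v ]) (home v) →
    total D ≤ b + total (D ∪ N[ v ])
  move-total D v b drop = sum-mono-except {a = 0} {b} (home v) drop (weight-away D v)

  finished⇒total≤0 : ∀ {D} → (∀ v → ¬ Legal D v) → total D ≤ 0
  finished⇒total≤0 {D} finished = begin
    total D           ≤⟨ sum-mono {k} (λ i → complete⇒weight≤0 {D} {i} λ {x} _ →
                           decidable-stable (x ∈? D) λ x∉D → finished x (x , v∈N[v] x , x∉D)) ⟩
    sum {k} (λ _ → 0) ≡⟨ sum-const k 0 ⟩
    k * 0             ≡⟨ *-zeroʳ k ⟩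
    0                 ∎
    where open ≤-Reasoning

  AllTouched : Subset n → Set
  AllTouched D = ∀ i → Nonempty (S i ∩ D)

  touched-mono : ∀ {D v} → AllTouched D → AllTouched (D ∪ N[ v ])
  touched-mono {D} {v} touched i with x , t ← touched i with x∈S , x∈D ← x∈p∩q⁻ (S i) D t =
    x , x∈p∩q⁺ (x∈S , p⊆p∪q N[ v ] x∈D)

  -- No weight exceeds 2 any more, and a move affects only the set at `home v`; so each move, by
  -- either player, costs at most 2.
  total≤-touched : ∀ p D a → AllTouched D → total D ≤ 2 * movesLeft p D a
  total≤-touched p D (acc rs) touched with movesLeft-sel rs p
  ... | inj₁ (_ , finished) = ≤-trans (finished⇒total≤0 finished) z≤n
  ... | inj₂ (v , l , e)    = begin
    total D                ≤⟨ move-total D v 2 (≤-trans (touched⇒weight≤2 (touched (home v))) (m≤m+n 2 _)) ⟩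
    2 + total (D ∪ N[ v ]) ≤⟨ +-monoʳ-≤ 2 (total≤-touched _ _ (rs (legal⇒⊃ l)) (touched-mono touched)) ⟩
    2 + 2 * later          ≡⟨ *-distribˡ-+ 2 1 later ⟨
    2 * suc later          ≡⟨ cong (2 *_) e ⟨
    2 * movesLeft p D (acc rs) ∎
    where
    open ≤-Reasoning
    later = movesLeft (opponent p) (D ∪ N[ v ]) (rs (legal⇒⊃ l))

  mutual

    -- Every remaining move pays for 2 units of weight. A move of Dominator may remove 3; the extra
    -- 1 covers the surplus, and a reply of Staller that removes only 1 restores it.
    total≤-Dominator : ∀ D a → total D ≤ 1 + 2 * movesLeft Dominator D a
    total≤-Dominator D (acc rs) with movesLeft-sel rs Dominator
    ... | inj₁ (_ , finished) = ≤-trans (finished⇒total≤0 finished) z≤n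
    ... | inj₂ (v , l , e)    = begin
      total D                       ≤⟨ move-total D v 3 (≤-trans (weight≤3 D (home v)) (m≤m+n 3 _)) ⟩
      3 + total (D ∪ N[ v ])        ≤⟨ +-monoʳ-≤ 3 (total≤-Staller _ (rs (legal⇒⊃ l))) ⟩
      1 + (2 + 2 * later)           ≡⟨ cong suc (*-distribˡ-+ 2 1 later) ⟨
      1 + 2 * suc later             ≡⟨ cong (λ x → 1 + 2 * x) e ⟨
      1 + 2 * movesLeft Dominator D (acc rs) ∎
      where
      open ≤-Reasoning
      later = movesLeft Staller (D ∪ N[ v ]) (rs (legal⇒⊃ l))

    total≤-Staller : ∀ D a → total D ≤ 2 * movesLeft Staller D a
    total≤-Staller D (acc rs) with all? (λ i → nonempty? (S i ∩ D))
    ... | yes touched = total≤-touched Staller D (acc rs) touched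
    ... | no ¬touched
      with i , fresh ← ¬∀⟶∃¬ k _ (λ i → nonempty? (S i ∩ D)) ¬touched
      with v , u , v∈S , u∈S , u∉N ← non-nbr i
      -- Playing `v` is legal because `v` lies in the untouched set and is therefore itself
      -- undominated.
      with l , move≤ ← legal⇒<movesLeft-Staller rs {v}
                         (v , v∈N[v] v , λ v∈D → fresh (v , x∈p∩q⁺ (v∈S , v∈D)))
      = begin
      total D                     ≤⟨ move-total D v 1 drop ⟩
      1 + total (D ∪ N[ v ])      ≤⟨ s≤s (total≤-Dominator _ (rs (legal⇒⊃ l))) ⟩
      2 + 2 * later               ≡⟨ *-distribˡ-+ 2 1 later ⟨
      2 * suc later               ≤⟨ *-monoʳ-≤ 2 move≤ ⟩
      2 * movesLeft Staller D (acc rs) ∎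
      where
      open ≤-Reasoning
      later = movesLeft Dominator (D ∪ N[ v ]) (rs (legal⇒⊃ l))
      u∉D∪N : u ∉ D ∪ N[ v ]
      u∉D∪N u∈ with x∈p∪q⁻ D N[ v ] u∈
      ... | inj₁ u∈D = fresh (u , x∈p∩q⁺ (u∈S , u∈D))
      ... | inj₂ u∈N = u∉N u∈N
      drop : weight D (home v) ≤ 1 + weight (D ∪ N[ v ]) (home v)
      -- Since `v` belongs to its own neighborhood, `i` is its home. The weight there is at most 3
      -- before the move and, as `u` stays undominated, at least 2 after it.
      drop = subst (λ j → weight D j ≤ 1 + weight (D ∪ N[ v ]) j) (private-nbhd v∈S (v∈N[v] v))
        (≤-trans (weight≤3 D i) (s≤s (incomplete⇒2≤weight u∈S u∉D∪N)))

  3k≤1+2γg : k * 3 ≤ 1 + 2 * γg T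
  3k≤1+2γg = begin
    k * 3             ≡⟨ sum-const k 3 ⟨
    sum {k} (λ _ → 3) ≤⟨ sum-mono {k} weight⊥ ⟩
    total ⊥           ≤⟨ total≤-Dominator ⊥ (⊃-wellFounded ⊥) ⟩
    1 + 2 * γg T      ∎
    where open ≤-Reasoning

-- The linked copies of K₄ and their spanning trees.

module LinkedK₄s (m : ℕ) where

  M : ℕ
  M = suc m

  -- A vertex codes a pair of a copy and a slot; slot `zero` holds the chosen vertex of the copy.
  V : Set
  V = Fin (M * 4)

  copy : V → Fin M
  copy = quotient 4

  slot : V → Fin 4
  slot = remainder {M} 4

  copy-combine : ∀ i j → copy (combine i j) ≡ i
  copy-combine i j = cong proj₁ (remQuot-combine {M} i j)

  slot-combine : ∀ (i : Fin M) j → slot (combine i j) ≡ j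
  slot-combine i j = cong proj₂ (remQuot-combine {M} i j)

  -- Left reflexive, so that legs of a path may degenerate to a single vertex; `Adj` removes the
  -- diagonal.
  Joined : V → V → Set
  Joined u v = copy u ≡ copy v ⊎ slot u ≡ zero × slot v ≡ zero

  G : Graph (M * 4)
  G = record
    { nonempty = _
    ; Adj      = λ u v → u ≢ v × Joined u v
    ; adj?     = λ u v → ¬? (u ≟ v) ×-dec
                   ((copy u ≟ copy v) ⊎-dec ((slot u ≟ zero) ×-dec (slot v ≟ zero)))
    ; symAdj   = λ { (u≢v , inj₁ same)    → u≢v ∘ sym , inj₁ (sym same)
                   ; (u≢v , inj₂ (p , q)) → u≢v ∘ sym , inj₂ (q , p) }
    ; irrefl   = λ u≡v (u≢v , _) → u≢v u≡v
    }

  joined⇒Star : ∀ {u v} → Joined u v → Star (Adj G) u v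
  joined⇒Star {u} {v} j with u ≟ v
  ... | yes refl = ε
  ... | no u≢v   = (u≢v , j) ◅ ε

  -- The path runs through the chosen vertices of the two copies.
  connected : Connected G
  connected u v =
    joined⇒Star {u} {combine (copy u) zero} (inj₁ (sym (copy-combine (copy u) zero))) ◅◅
    joined⇒Star (inj₂ (slot-combine (copy u) zero , slot-combine (copy v) zero)) ◅◅
    joined⇒Star {combine (copy v) zero} {v} (inj₁ (copy-combine (copy v) zero))

  K : Fin (suc M) → Subset (M * 4)
  K zero    = ⟦ (λ v → slot v ≟ zero) ⟧
  K (suc i) = ⟦ (λ v → copy v ≟ i) ⟧

  S : Fin M → Subset (M * 4)
  S i = ⟦ (λ v → (copy v ≟ i) ×-dec ¬? (slot v ≟ zero)) ⟧

  K-joined : ∀ c {u v} → u ∈ K c → v ∈ K c → Joined v u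
  K-joined zero    u∈K v∈K = inj₂ (∈⟦⟧⁻ (λ v → slot v ≟ zero) v∈K , ∈⟦⟧⁻ (λ v → slot v ≟ zero) u∈K)
  K-joined (suc i) u∈K v∈K = inj₁ (trans (∈⟦⟧⁻ (λ v → copy v ≟ i) v∈K) (sym (∈⟦⟧⁻ (λ v → copy v ≟ i) u∈K)))

  K-clique : ∀ c {u v} → u ∈ K c → v ∈ K c → u ∈ Game.N[_] G v
  K-clique c {u} {v} u∈K v∈K with u ≟ v
  ... | yes u≡v = ∈⟦⟧⁺ (Game.inN? G v) (inj₁ u≡v)
  ... | no u≢v  = ∈⟦⟧⁺ (Game.inN? G v) (inj₂ (u≢v ∘ sym , K-joined c u∈K v∈K))

  K-cover : ∀ {u v} → u ∈ Game.N[_] G v → ∃ λ c → u ∈ K c × v ∈ K c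
  K-cover {u} {v} u∈N with ∈⟦⟧⁻ (Game.inN? G v) u∈N
  ... | inj₁ refl = suc (copy v) , ∈⟦⟧⁺ (λ x → copy x ≟ copy v) refl , ∈⟦⟧⁺ (λ x → copy x ≟ copy v) refl
  ... | inj₂ (_ , inj₁ same) =
    suc (copy v) , ∈⟦⟧⁺ (λ x → copy x ≟ copy v) (sym same) , ∈⟦⟧⁺ (λ x → copy x ≟ copy v) refl
  ... | inj₂ (_ , inj₂ (v₀ , u₀)) =
    zero , ∈⟦⟧⁺ (λ x → slot x ≟ zero) u₀ , ∈⟦⟧⁺ (λ x → slot x ≟ zero) v₀

  γg-G≤ : γg G ≤ suc M
  γg-G≤ = EdgeCliqueCover.γg≤k G K K-clique K-cover

  module _ (T : Graph (M * 4)) (T⊆G : ∀ {u v} → Adj T u v → Adj G u v) (acyclic : ¬ Cycle T) where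

    -- Edges of `T` are edges of `G`, and an edge of `G` between different copies has both ends in
    -- slot `zero`, which `S i` excludes.
    private-nbhd : ∀ {i u v} → u ∈ S i → u ∈ Game.N[_] T v → i ≡ copy v
    private-nbhd {i} {u} {v} u∈S u∈N
      with refl , u≢0 ← ∈⟦⟧⁻ (λ x → (copy x ≟ i) ×-dec ¬? (slot x ≟ zero)) u∈S
      with ∈⟦⟧⁻ (Game.inN? T v) u∈N
    ... | inj₁ refl = refl
    ... | inj₂ adj with T⊆G adj
    ...   | _ , inj₁ same    = sym same
    ...   | _ , inj₂ (_ , u₀) = contradiction u₀ u≢0

    module _ (i : Fin M) where

      x : Fin 3 → V
      x j = combine i (suc j)

      x-injective : ∀ {j k} → x j ≡ x k → j ≡ k
      x-injective {j} {k} e = suc-injective (combine-injectiveʳ i (suc j) i (suc k) e)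

      x∈S : ∀ j → x j ∈ S i
      x∈S j = ∈⟦⟧⁺ (λ v → (copy v ≟ i) ×-dec ¬? (slot v ≟ zero))
        (copy-combine i (suc j) , λ e → contradiction (trans (sym (slot-combine i (suc j))) e) λ ())

      ¬adj⇒non-nbr : ∀ j k → k ≢ j → ¬ Adj T (x j) (x k) →
        ∃₂ λ v u → v ∈ S i × u ∈ S i × u ∉ Game.N[_] T v
      ¬adj⇒non-nbr j k k≢j ¬adj = x j , x k , x∈S j , x∈S k , not-nbr
        where
        not-nbr : x k ∉ Game.N[_] T (x j)
        not-nbr ∈N with ∈⟦⟧⁻ (Game.inN? T (x j)) ∈N
        ... | inj₁ e   = k≢j (x-injective e)
        ... | inj₂ adj = ¬adj adj

      non-nbr : ∃₂ λ v u → v ∈ S i × u ∈ S i × u ∉ Game.N[_] T v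
      non-nbr with adj? T (x 0F) (x 1F) | adj? T (x 1F) (x 2F) | adj? T (x 2F) (x 0F)
      ... | no ¬01 | _      | _      = ¬adj⇒non-nbr 0F 1F (λ ()) ¬01
      ... | yes _  | no ¬12 | _      = ¬adj⇒non-nbr 1F 2F (λ ()) ¬12
      ... | yes _  | yes _  | no ¬20 = ¬adj⇒non-nbr 2F 0F (λ ()) ¬20
      ... | yes a  | yes b  | yes c  = contradiction triangle acyclic
        where
        triangle : Cycle T
        triangle = record
          -- A `Cycle` has `3 + k` vertices, so `k = 0` is a triangle.
          { k = 0 ; c = x ; distinct = x-injective
          ; step = λ { 0F → a ; 1F → b } ; close = c }

    3M≤1+2γg-T : M * 3 ≤ 1 + 2 * γg T
    3M≤1+2γg-T = PrivateSets.3k≤1+2γg T S copy private-nbhd non-nbr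

-- Arithmetic and the final comparison.

⊖-mono-sum : ∀ a b c d → c + b ≤ a + d → c ⊖ d ≤ᶻ a ⊖ b
⊖-mono-sum a b c d c+b≤a+d = begin
  c ⊖ d             ≡⟨ ℤ.+-cancelˡ-⊖ b c d ⟨
  -- Both differences are brought to the common subtrahend `d + b`, where only the minuends are
  -- compared.
  (b + c) ⊖ (b + d) ≡⟨ cong₂ _⊖_ (+-comm b c) (+-comm b d) ⟩
  (c + b) ⊖ (d + b) ≤⟨ ℤ.⊖-monoˡ-≤ (d + b) c+b≤a+d ⟩
  (a + d) ⊖ (d + b) ≡⟨ cong (_⊖ (d + b)) (+-comm a d) ⟩
  (d + a) ⊖ (d + b) ≡⟨ ℤ.+-cancelˡ-⊖ d a b ⟩
  a ⊖ b             ∎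
  where open ℤ.≤-Reasoning

-- With `2 * r + 1` copies the lower bound reads `6 * r + 3 ≤ 1 + 2 * t`; dropping 1 and halving
-- gives `1 + 3 * r ≤ t`, while `r + g` is at most `3 * r + 2`.
bounds⇒gap : ∀ r g t → g ≤ suc (suc (2 * r)) → suc (2 * r) * 3 ≤ 1 + 2 * t → r + g ≤ t + 1
bounds⇒gap r g t g≤ ≤t = begin
  r + g                       ≤⟨ +-monoʳ-≤ r g≤ ⟩
  r + suc (suc (2 * r))       ≡⟨ regroup r ⟩
  (1 + 3 * r) + 1             ≤⟨ +-monoˡ-≤ 1 1+3r≤t ⟩
  t + 1                       ∎
  where
  open ≤-Reasoning
  regroup : ∀ r → r + suc (suc (2 * r)) ≡ (1 + 3 * r) + 1
  regroup = solve-∀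
  double : ∀ r → suc (2 * (1 + 3 * r)) ≡ suc (2 * r) * 3
  double = solve-∀
  1+3r≤t : 1 + 3 * r ≤ t
  1+3r≤t = *-cancelˡ-≤ 2 (ℕ.s≤s⁻¹ (≤-trans (≤-reflexive (double r)) ≤t))

theorem4p4 : (r m : ℕ) → r ℕ.≥ 1 → m ≡ 2 ℕ.* r →
    ∃[ n ] Σ[ Gₘ ∈ Graph n ] (Connected Gₘ × ((T : Graph n) → IsSpanningTree T Gₘ → (+ γg T) - (+ γg Gₘ) ≥ (+ r) - 1ℤ))
theorem4p4 r m _ refl = _ , G , connected , gap
  where
  open LinkedK₄s m
  gap : (T : Graph (M * 4)) → IsSpanningTree T G → (+ γg T) - (+ γg G) ≥ (+ r) - 1ℤ
  gap T (T⊆G , _ , acyclic) = begin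
    (+ r) - 1ℤ          ≡⟨ ℤ.[+m]-[+n]≡m⊖n r 1 ⟩
    r ⊖ 1               ≤⟨ ⊖-mono-sum (γg T) (γg G) r 1
                             (bounds⇒gap r (γg G) (γg T) γg-G≤ (3M≤1+2γg-T T T⊆G acyclic)) ⟩
    γg T ⊖ γg G         ≡⟨ ℤ.[+m]-[+n]≡m⊖n (γg T) (γg G) ⟨
    (+ γg T) - (+ γg G) ∎
    where open ℤ.≤-Reasoning
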